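{- Every graph of tree-width $k$ has fusion-width at most $k+2$.
   Context: Graphs are finite, simple, undirected and nonempty. The tree-width $\mathrm{tw}(G)$ is the smallest integer $k$ such that $G$ has a tree decomposition with largest bag size $k+1$. A $k$-fusion-tree expression is an expression built from atoms $i\langle m\rangle$, unary operations $\eta_{i,j}$, $\rho_{i\to j}$, $\theta_i$, and the binary operation $\oplus$, with labels $i,j\in\{1,\dots,k\}$, where: $i\langle m\rangle$ creates a graph consisting of $m$ isolated vertices labeled $i$; $\eta_{i,j}$ (for $i\neq j$) creates an edge between every vertex with label $i$ and every vertex with label $j$; $\rho_{i\to j}$ changes all labels $i$ to $j$; $\theta_i$ merges all vertices labeled $i$ into one vertex, which is labeled $i$ and is adjacent to every vertex not labeled $i$ to which some vertex labeled $i$ was adjacent before the operation; $\oplus$ forms the disjoint union of two labeled graphs. The generated graph is obtained by finally deleting all labels. The fusion-width $\mathrm{fw}(G)$ is the smallest $k$ such that there is a $k$-fusion-tree expression generating $G$. -}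

module Defs where

open import Data.Empty using (⊥)
open import Data.Fin.Base using (Fin)
open import Data.Fin.Properties using (_≟_)
open import Data.Fin.Subset using (Subset; _∈_; ∣_∣)
open import Data.List.Base using (List; _∷_; _∷ʳ_; length)
open import Data.List.Relation.Unary.Linked using (Linked)
open import Data.List.Relation.Unary.Unique.Propositional using (Unique)
open import Data.Nat.Base using (ℕ; suc; _≤_; NonZero)
open import Data.Product.Base using (∃-syntax; Σ-syntax; _×_)
open import Data.Sum.Base using (_⊎_; inj₁; inj₂)
open import Function.Bundles using (_↔_; _⇔_; Inverse)
open import Level using (0ℓ)
open import Relation.Binary.Construct.Closure.ReflexiveTransitive using (Star)
open import Relation.Binary.Core using (Rel)
open import Relation.Binary.Definitions using (Decidable; Symmetric)
open import Relation.Binary.PropositionalEquality.Core using (_≡_; _≢_)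
open import Relation.Nullary using (¬_; yes; no)

Least : ∀ {ℓ} → (ℕ → Set ℓ) → ℕ → Set ℓ
Least P n = P n × (∀ m → P m → n ≤ m)

record Graph : Set₁ where
  field
    order    : ℕ
    nonempty : NonZero order

  Vertex : Set
  Vertex = Fin order

  infix 4 _~_
  field
    _~_      : Rel Vertex 0ℓ
    _~?_     : Decidable _~_
    ~-sym    : Symmetric _~_
    ~-irrefl : ∀ {v} → ¬ (v ~ v)

module _ (G : Graph) where
  open Graph G

  Connected : Set
  Connected = ∀ u v → Star _~_ u v

  -- The cycle x, xs₁, …, xsₘ, x with at least three distinct vertices.
  IsCycle : Vertex → List Vertex → Set
  IsCycle x xs = Linked _~_ (x ∷ (xs ∷ʳ x)) × Unique (x ∷ xs) × 2 ≤ length xs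

  IsTree : Set
  IsTree = Connected × (∀ x xs → ¬ IsCycle x xs)

record TreeDecomposition (G : Graph) : Set₁ where
  open Graph G
  field
    tree   : Graph
    isTree : IsTree tree

  open Graph tree using () renaming (Vertex to Node; _~_ to _~ᵀ_)

  field
    bag          : Node → Subset order
    vertex-cover : ∀ v → ∃[ t ] v ∈ bag t
    edge-cover   : ∀ {u v} → u ~ v → ∃[ t ] (u ∈ bag t × v ∈ bag t)
    -- The nodes whose bags contain v induce a connected subgraph of the tree.
    connected    : ∀ v {s t} → v ∈ bag s → v ∈ bag t →
                   Star (λ a b → a ~ᵀ b × v ∈ bag a × v ∈ bag b) s t

  LargestBagSize : ℕ → Set
  LargestBagSize m = (∀ t → ∣ bag t ∣ ≤ m) × (∃[ t ] ∣ bag t ∣ ≡ m)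

-- A graph is nonempty, so some bag is nonempty, the width of a decomposition
-- is never -1, and natural numbers suffice.
TreeWidth : Graph → ℕ → Set₁
TreeWidth G = Least λ k →
  Σ[ D ∈ TreeDecomposition G ] TreeDecomposition.LargestBagSize D (suc k)

data FusionTree (k : ℕ) : Set where
  _⟨_⟩ : Fin k → (m : ℕ) → .{{NonZero m}} → FusionTree k
  η    : (i j : Fin k) → i ≢ j → FusionTree k → FusionTree k
  ρ    : (i j : Fin k) → FusionTree k → FusionTree k
  θ    : Fin k → FusionTree k → FusionTree k
  _⊕_  : FusionTree k → FusionTree k → FusionTree k

record LabelledGraph (k : ℕ) : Set₁ where
  infix 4 _~_
  field
    Vertex : Set
    label  : Vertex → Fin k
    _~_    : Rel Vertex 0ℓ

module _ {k : ℕ} where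

  isolated : Fin k → ℕ → LabelledGraph k
  isolated i m = record
    { Vertex = Fin m
    ; label  = λ _ → i
    ; _~_    = λ _ _ → ⊥
    }

  join : Fin k → Fin k → LabelledGraph k → LabelledGraph k
  join i j H = record
    { Vertex = Vertex
    ; label  = label
    ; _~_    = λ u v → u ~ v
                     ⊎ (label u ≡ i × label v ≡ j)
                     ⊎ (label u ≡ j × label v ≡ i)
    }
    where open LabelledGraph H

  relabelLabel : Fin k → Fin k → Fin k → Fin k
  relabelLabel i j l with l ≟ i
  ... | yes _ = j
  ... | no  _ = l

  relabel : Fin k → Fin k → LabelledGraph k → LabelledGraph k
  relabel i j H = record
    { Vertex = Vertex
    ; label  = λ v → relabelLabel i j (label v)
    ; _~_    = _~_
    }
    where open LabelledGraph H

  module Fuse (i : Fin k) (H : LabelledGraph k) where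
    open LabelledGraph H

    -- The merged vertex exists only if some vertex is labelled i.  The
    -- irrelevant arguments make it unique, and keep one copy of each
    -- other vertex.
    data Fused : Set where
      kept   : (v : Vertex) → .(label v ≢ i) → Fused
      merged : .(∃[ v ] label v ≡ i) → Fused

    fusedLabel : Fused → Fin k
    fusedLabel (kept v _) = label v
    fusedLabel (merged _) = i

    fusedAdj : Rel Fused 0ℓ
    fusedAdj (kept u _) (kept v _) = u ~ v
    fusedAdj (kept u _) (merged _) = ∃[ w ] (label w ≡ i × u ~ w)
    fusedAdj (merged _) (kept v _) = ∃[ w ] (label w ≡ i × w ~ v)
    fusedAdj (merged _) (merged _) = ⊥

  fuse : Fin k → LabelledGraph k → LabelledGraph k
  fuse i H = record { Vertex = Fused ; label = fusedLabel ; _~_ = fusedAdj }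
    where open Fuse i H

  module DisjointUnion (H K : LabelledGraph k) where
    private
      module H = LabelledGraph H
      module K = LabelledGraph K

    unionLabel : H.Vertex ⊎ K.Vertex → Fin k
    unionLabel (inj₁ u) = H.label u
    unionLabel (inj₂ v) = K.label v

    unionAdj : Rel (H.Vertex ⊎ K.Vertex) 0ℓ
    unionAdj (inj₁ u) (inj₁ v) = u H.~ v
    unionAdj (inj₂ u) (inj₂ v) = u K.~ v
    unionAdj (inj₁ _) (inj₂ _) = ⊥
    unionAdj (inj₂ _) (inj₁ _) = ⊥

  disjointUnion : LabelledGraph k → LabelledGraph k → LabelledGraph k
  disjointUnion H K = record
    { Vertex = LabelledGraph.Vertex H ⊎ LabelledGraph.Vertex K
    ; label  = unionLabel
    ; _~_    = unionAdj
    }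
    where open DisjointUnion H K

  ⟦_⟧ : FusionTree k → LabelledGraph k
  ⟦ i ⟨ m ⟩ ⟧   = isolated i m
  ⟦ η i j _ e ⟧ = join i j ⟦ e ⟧
  ⟦ ρ i j e ⟧   = relabel i j ⟦ e ⟧
  ⟦ θ i e ⟧     = fuse i ⟦ e ⟧
  ⟦ e ⊕ f ⟧     = disjointUnion ⟦ e ⟧ ⟦ f ⟧

  -- Isomorphism with G of the graph left after deleting the labels.
  Generates : FusionTree k → Graph → Set
  Generates e G =
    Σ[ φ ∈ (G.Vertex ↔ H.Vertex) ]
      (∀ u v → (u G.~ v) ⇔ (Inverse.to φ u H.~ Inverse.to φ v))
    where
    module G = Graph G
    module H = LabelledGraph ⟦ e ⟧

HasFusionTree : Graph → ℕ → Set
HasFusionTree G k = Σ[ e ∈ FusionTree k ] Generates e G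

FusionWidth : Graph → ℕ → Set
FusionWidth G = Least (HasFusionTree G)

-- The fusion-width of G is defined and is at most m.  Classically, a set of
-- naturals has a least element as soon as it is inhabited; constructively
-- computing that element would require deciding HasFusionTree, so the first
-- component only exhibits a member that is at most m.
FusionWidthAtMost : Graph → ℕ → Set
FusionWidthAtMost G m =
  (∃[ w ] (w ≤ m × HasFusionTree G w)) × (∀ w → FusionWidth G w → w ≤ m)

{-# OPTIONS --safe #-}
-- By acyclicity the nodes of the decomposition can be listed so that each new
-- bag meets the union of the earlier bags inside a single earlier bag, that of
-- its parent.  Along this order the vertices are coloured with k + 1 colours,
-- injectively on every bag.  Going back through the list, each node carries an
-- expression for what has been absorbed into it: vertices in its bag are
-- labelled by their colour, all others by one extra dead label.  A leaf is
-- absorbed into its parent by turning dead the labels of the vertices missing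
-- from the parent's bag, taking the disjoint union, and applying θ to every
-- colour, which identifies exactly the two copies of each shared vertex.
module Submission where

open import Defs
open import Data.Nat.Base using (ℕ; _+_)
open import Data.Bool.Base using (true; false)
open import Data.Empty using (⊥; ⊥-elim; ⊥-elim-irr)
open import Data.Fin.Base using (Fin; zero; suc)
open import Data.Fin.Properties using (_≟_; any?; ¬∀⟶∃¬; pigeonhole; suc-injective; <⇒≢)
open import Data.Fin.Subset using (Subset; ∣_∣; _-_) renaming (_∈_ to _∈ₛ_)
open import Data.Fin.Subset.Properties
  using (x∈p⇒∣p-x∣<∣p∣; x∈p∧x≢y⇒x∈p-y) renaming (_∈?_ to _∈ₛ?_)
open import Data.List.Base
  using (List; []; _∷_; _∷ʳ_; length; map; lookup; allFin; cartesianProduct)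
open import Data.List.Membership.Propositional using (_∈_; _∉_)
open import Data.List.Membership.Propositional.Properties
  using (∈-allFin; ∈-map⁺; ∈-cartesianProduct⁺)
open import Data.List.Properties using (length-map)
open import Data.List.Relation.Unary.All as All using (All; []; _∷_)
open import Data.List.Relation.Unary.All.Properties using (¬Any⇒All¬; map⁺)
open import Data.List.Relation.Unary.AllPairs using ([]; _∷_)
open import Data.List.Relation.Unary.Any using (here; there; index)
open import Data.List.Relation.Unary.Any.Properties using (lookup-index)
open import Data.List.Relation.Unary.Linked using (Linked; [-]; _∷_)
open import Data.List.Relation.Unary.Unique.Propositional using (Unique)
open import Data.Nat.Base using (suc; _≤_; _<_; z≤n; s≤s; NonZero)
open import Data.Nat.Properties using (+-comm; ≤-refl; <-≤-trans)
open import Data.Product.Base using (∃-syntax; Σ-syntax; _×_; _,_; proj₁; proj₂)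
open import Data.Sum.Base using (_⊎_; inj₁; inj₂; [_,_]′)
open import Data.Vec.Base using ([]; _∷_; here; there)
open import Data.Vec.Functional using (updateAt)
open import Data.Vec.Functional.Properties using (updateAt-updates; updateAt-minimal)
open import Function.Base using (_∘_; id; const)
open import Function.Bundles using (mk↔ₛ′; mk⇔)
open import Level using (0ℓ)
open import Relation.Binary.Construct.Closure.ReflexiveTransitive as Star
  using (Star; ε; _◅_; _◅◅_)
open import Relation.Binary.Core using (Rel)
open import Relation.Binary.PropositionalEquality
  using (_≡_; _≢_; refl; sym; trans; cong; subst; subst₂)
open import Relation.Nullary using (¬_; Dec; yes; no; contradiction; recompute)
open import Relation.Nullary.Decidable using (map′; _×-dec_; _⊎-dec_)

-- Simple paths and bridges

module _ {n : ℕ} (R : Rel (Fin n) 0ℓ) (z : Fin n) where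

  open import Data.List.Membership.DecPropositional (_≟_ {n}) using (_∈?_)

  -- Path a xs: the walk from a visiting xs, whose last vertex is z.
  data Path : Fin n → List (Fin n) → Set where
    end  : Path z []
    step : ∀ {a b xs} → R a b → Path b xs → Path a (b ∷ xs)

  SimplePath : Fin n → Set
  SimplePath a = ∃[ xs ] (Path a xs × Unique (a ∷ xs))

  suffix : ∀ {a b xs} → Path b xs → Unique (b ∷ xs) → a ∈ b ∷ xs → SimplePath a
  suffix path       unique       (here refl) = _ , path , unique
  suffix (step _ p) (_ ∷ unique) (there a∈)  = suffix p unique a∈

  -- If `a` already occurs on the simple path found from `b`, the part of that path from `a` onwards
  -- is kept; otherwise the path is extended by the step.
  loop-erasure : ∀ {a} → Star R a z → SimplePath a
  loop-erasure ε = [] , end , [] ∷ []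
  loop-erasure {a} (_◅_ {j = b} r walk) with loop-erasure walk
  ... | xs , path , unique with a ∈? (b ∷ xs)
  ...   | yes a∈ = suffix path unique a∈
  ...   | no  a∉ = b ∷ xs , step r path , ¬Any⇒All¬ (b ∷ xs) a∉ ∷ unique

  -- Appending `c` after the last vertex `z` gives the closed form that `IsCycle` expects when `c`
  -- is `a`.
  Path⇒Linked : ∀ {S : Rel (Fin n) 0ℓ} {a c xs} → (∀ {u v} → R u v → S u v) →
                S z c → Path a xs → Linked S (a ∷ (xs ∷ʳ c))
  Path⇒Linked f s end        = s ∷ [-]
  Path⇒Linked f s (step r p) = f r ∷ Path⇒Linked f s p

module _ (T : Graph) where
  open Graph T

  -- One direction of the edge is enough to forbid: a simple path starting at `t` cannot return to
  -- `t`, so it never uses the step from `p` to `t`.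
  Avoiding : Vertex → Vertex → Rel Vertex 0ℓ
  Avoiding t p a b = a ~ b × ¬ (a ≡ t × b ≡ p)

  -- Loop erasure turns such a walk into a simple path that is not the single step from `t` to `p`.
  -- It has at least two steps, so the edge back from `p` closes it to a cycle.
  acyclic⇒bridge : (∀ x xs → ¬ IsCycle T x xs) →
                   ∀ {t p} → t ~ p → ¬ Star (Avoiding t p) t p
  acyclic⇒bridge acyclic {t} {p} t~p walk with loop-erasure (Avoiding t p) p walk
  ... | xs , path , unique = acyclic t xs
    (Path⇒Linked _ _ proj₁ (~-sym t~p) path , unique , long path)
    where
    long : ∀ {xs} → Path (Avoiding t p) p t xs → 2 ≤ length xs
    long end                           = contradiction t~p ~-irrefl
    long (step (_ , t≢p) end)          = contradiction (refl , refl) t≢p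
    long (step _ (step _ _))           = s≤s (s≤s z≤n)

-- Elimination orders of a tree decomposition

-- The list has the last attached node first and the root last, so its head is a leaf with parent
-- `p`. The third argument of `attach` is the running intersection property.
data JoinTree {m n : ℕ} (bag : Fin m → Subset n) : List (Fin m) → Set where
  root   : ∀ r → JoinTree bag (r ∷ [])
  attach : ∀ {t p ts} → t ∉ ts → p ∈ ts →
           (∀ {v s} → s ∈ ts → v ∈ₛ bag t → v ∈ₛ bag s → v ∈ₛ bag p) →
           JoinTree bag ts → JoinTree bag (t ∷ ts)

module _ {G : Graph} (D : TreeDecomposition G) where
  open TreeDecomposition D
  open Graph tree using () renaming (_~_ to _~ᵀ_; Vertex to Node; ~-sym to ~ᵀ-sym)
  open import Data.List.Membership.DecPropositional (_≟_ {Graph.order tree}) using (_∈?_)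

  Within : List Node → Rel Node 0ℓ
  Within ts a b = a ~ᵀ b × a ∈ ts × b ∈ ts

  -- Suppose `v` is not in the bag of `p`. The walk from `t` to `s` through bags containing `v`
  -- never enters `p`, and the walk from `s` to `p` inside `ts` never leaves from `t`. Together they
  -- bypass the bridge between `t` and `p`.
  running-intersection :
    ∀ {t p s ts v} → t ∉ ts → t ~ᵀ p → Star (Within ts) s p →
    v ∈ₛ bag t → v ∈ₛ bag s → v ∈ₛ bag p
  running-intersection {t} {p} {s} {ts} {v} t∉ t~p inside v∈t v∈s with v ∈ₛ? bag p
  ... | yes v∈p = v∈p
  ... | no  v∉p = contradiction
    (Star.map (λ (a~b , _ , v∈b) → a~b , λ { (_ , refl) → v∉p v∈b }) (connected v v∈t v∈s)
      ◅◅ Star.map (λ (a~b , a∈ , _) → a~b , λ { (refl , _) → t∉ a∈ }) inside)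
    (acyclic⇒bridge tree (proj₂ isTree) t~p)

  -- Connectivity of the listed nodes is carried along because it supplies the inner walk that
  -- `running-intersection` asks for.
  record Grown (ts : List Node) : Set where
    field
      joinTree : JoinTree bag ts
      walk     : ∀ {a b} → a ∈ ts → b ∈ ts → Star (Within ts) a b

  open Grown

  grow : ∀ {t p ts} → Grown ts → t ∉ ts → p ∈ ts → t ~ᵀ p → Grown (t ∷ ts)
  grow {t} {p} {ts} g t∉ p∈ t~p = record
    { joinTree = attach t∉ p∈
        (λ s∈ → running-intersection t∉ t~p (walk g s∈ p∈)) (joinTree g)
    ; walk     = λ
        { (here refl) (here refl) → ε
        ; (here refl) (there b∈)  → (t~p , here refl , there p∈) ◅ weaken (walk g p∈ b∈)
        ; (there a∈)  (here refl) → weaken (walk g a∈ p∈)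
                                      ◅◅ (~ᵀ-sym t~p , there p∈ , here refl) ◅ ε
        ; (there a∈)  (there b∈)  → weaken (walk g a∈ b∈)
        }
    }
    where
    weaken : ∀ {a b} → Star (Within ts) a b → Star (Within (t ∷ ts)) a b
    weaken = Star.map (λ (a~b , a∈ , b∈) → a~b , there a∈ , there b∈)

  -- Follows the walk and attaches each node not yet listed, with its predecessor on the walk as
  -- parent.
  absorb : ∀ {ts a x} → Grown ts → a ∈ ts → Star _~ᵀ_ a x →
           ∃[ us ] (Grown us × (∀ {b} → b ∈ ts → b ∈ us) × x ∈ us)
  absorb g a∈ ε = _ , g , id , a∈
  absorb {ts} g a∈ (_◅_ {j = b} a~b rest) with b ∈? ts
  ... | yes b∈ = absorb g b∈ rest
  ... | no  b∉ with absorb (grow g b∉ a∈ (~ᵀ-sym a~b)) (here refl) rest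
  ...   | us , g′ , ⊆us , x∈ = us , g′ , ⊆us ∘ there , x∈

  absorb-all : Node → (xs : List Node) →
               ∃[ ts ] (Grown ts × (∃[ a ] a ∈ ts) × (∀ {x} → x ∈ xs → x ∈ ts))
  absorb-all r [] =
    r ∷ [] ,
    record { joinTree = root r ; walk = λ { (here refl) (here refl) → ε } } ,
    (r , here refl) ,
    λ ()
  absorb-all r (x ∷ xs) with absorb-all r xs
  ... | ts , g , (a , a∈) , xs⊆ with absorb g a∈ (proj₁ isTree a x)
  ...   | us , g′ , ⊆us , x∈ =
    us , g′ , (a , ⊆us a∈) , λ { (here refl) → x∈ ; (there y∈) → ⊆us (xs⊆ y∈) }

  joinTree-all : Node → ∃[ ts ] (JoinTree bag ts × (∀ t → t ∈ ts))
  joinTree-all r with absorb-all r (allFin _)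
  ... | ts , g , _ , all∈ = ts , joinTree g , λ t → all∈ (∈-allFin t)

-- Colourings injective on every bag

elements : ∀ {n} → Subset n → List (Fin n)
elements []          = []
elements (true ∷ p)  = zero ∷ map suc (elements p)
elements (false ∷ p) = map suc (elements p)

length-elements : ∀ {n} (p : Subset n) → length (elements p) ≡ ∣ p ∣
length-elements []          = refl
length-elements (true ∷ p)  =
  cong suc (trans (length-map suc (elements p)) (length-elements p))
length-elements (false ∷ p) = trans (length-map suc (elements p)) (length-elements p)

∈-elements : ∀ {n v} (p : Subset n) → v ∈ₛ p → v ∈ elements p
∈-elements (true ∷ p)  here       = here refl
∈-elements (true ∷ p)  (there v∈) = there (∈-map⁺ suc (∈-elements p v∈))
∈-elements (false ∷ p) (there v∈) = ∈-map⁺ suc (∈-elements p v∈)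

-- If every colour occurred, choosing a position for each would inject `m` colours into fewer than
-- `m` positions.
short⇒missing : ∀ {m} (xs : List (Fin m)) → length xs < m → ∃[ x ] x ∉ xs
short⇒missing {m} xs short = ¬∀⟶∃¬ m (_∈ xs) (_∈? xs) λ all∈ →
  let i , j , i<j , eq = pigeonhole short (index ∘ all∈) in
  <⇒≢ i<j (trans (lookup-index (all∈ i))
            (trans (cong (lookup xs) eq) (sym (lookup-index (all∈ j)))))
  where open import Data.List.Membership.DecPropositional (_≟_ {m}) using (_∈?_)

InjectiveOn : ∀ {n m} → (Fin n → Set) → (Fin n → Fin m) → Set
InjectiveOn P c = ∀ {u v} → P u → P v → c u ≡ c v → u ≡ v

module _ {n m : ℕ} {B : Subset n} (small : ∣ B ∣ ≤ m)
         {Fixed : Fin n → Set} (fixed? : ∀ v → Dec (Fixed v)) where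

  Done : List (Fin n) → Fin n → Set
  Done vs v = v ∈ₛ B × (Fixed v ⊎ v ∈ vs)

  -- The other vertices of `B` number fewer than `m`, so they cannot use up all `m` colours.
  free-colour : ∀ {v} → v ∈ₛ B → (c : Fin n → Fin m) →
                ∃[ x ] (∀ {w} → w ∈ₛ B → w ≢ v → c w ≢ x)
  free-colour {v} v∈ c with short⇒missing (map c (elements (B - v))) short
    where
    short : length (map c (elements (B - v))) < m
    short = subst (_< m)
      (sym (trans (length-map c (elements (B - v))) (length-elements (B - v))))
      (<-≤-trans (x∈p⇒∣p-x∣<∣p∣ v∈) small)
  ... | x , x∉ = x , λ { w∈ w≢v refl →
    x∉ (∈-map⁺ c (∈-elements (B - v) (x∈p∧x≢y⇒x∈p-y w∈ w≢v))) }

  -- Greedy colouring: each vertex of `B` that is not fixed receives a colour absent from the rest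
  -- of `B`. `Done vs` is the set on which injectivity has been reached after the vertices in `vs`.
  recolour : (c : Fin n → Fin m) → InjectiveOn (λ v → v ∈ₛ B × Fixed v) c →
             (vs : List (Fin n)) →
             ∃[ c′ ] ((∀ v → v ∈ₛ B → ¬ Fixed v ⊎ c′ v ≡ c v)
                     × (∀ v → ¬ (v ∈ₛ B) → c′ v ≡ c v)
                     × InjectiveOn (Done vs) c′)
  recolour c inj [] = c , (λ _ _ → inj₂ refl) , (λ _ _ → refl) ,
    λ { (u∈ , inj₁ fu) (v∈ , inj₁ fv) → inj (u∈ , fu) (v∈ , fv) }
  recolour c inj (v ∷ vs) with recolour c inj vs
  ... | c′ , onB , offB , inj′ with fixed? v | v ∈ₛ? B
  ...   | yes fv | _ = c′ , onB , offB , λ x y → inj′ (drop x) (drop y)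
    where
    drop : ∀ {u} → Done (v ∷ vs) u → Done vs u
    drop (u∈ , inj₁ fu)          = u∈ , inj₁ fu
    drop (u∈ , inj₂ (here refl)) = u∈ , inj₁ fv
    drop (u∈ , inj₂ (there u∈s)) = u∈ , inj₂ u∈s
  ...   | no _   | no v∉ = c′ , onB , offB , λ x y → inj′ (drop x) (drop y)
    where
    drop : ∀ {u} → Done (v ∷ vs) u → Done vs u
    drop (u∈ , inj₁ fu)          = u∈ , inj₁ fu
    drop (u∈ , inj₂ (here refl)) = contradiction u∈ v∉
    drop (u∈ , inj₂ (there u∈s)) = u∈ , inj₂ u∈s
  ...   | no ¬fv | yes v∈ = c″ , onB″ , offB″ , inj″
    where
    x : Fin m
    x = proj₁ (free-colour v∈ c′)
    c″ : Fin n → Fin m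
    c″ = updateAt c′ v (const x)
    new : c″ v ≡ x
    new = updateAt-updates v c′
    old : ∀ {u} → u ≢ v → c″ u ≡ c′ u
    old {u} = updateAt-minimal u v c′
    onB″ : ∀ u → u ∈ₛ B → ¬ Fixed u ⊎ c″ u ≡ c u
    onB″ u u∈ with u ≟ v
    ... | yes refl = inj₁ ¬fv
    ... | no  u≢v  = [ inj₁ , inj₂ ∘ trans (old u≢v) ]′ (onB u u∈)
    offB″ : ∀ u → ¬ (u ∈ₛ B) → c″ u ≡ c u
    offB″ u u∉ = trans (old λ { refl → u∉ v∈ }) (offB u u∉)
    drop : ∀ {u} → u ≢ v → Done (v ∷ vs) u → Done vs u
    drop u≢v (u∈ , inj₁ fu)           = u∈ , inj₁ fu
    drop u≢v (u∈ , inj₂ (here u≡v))   = contradiction u≡v u≢v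
    drop u≢v (u∈ , inj₂ (there u∈vs)) = u∈ , inj₂ u∈vs
    fresh : ∀ {u} → u ∈ₛ B → u ≢ v → c″ u ≢ c″ v
    fresh u∈ u≢v eq = proj₂ (free-colour v∈ c′) u∈ u≢v
      (trans (sym (old u≢v)) (trans eq new))
    inj″ : InjectiveOn (Done (v ∷ vs)) c″
    inj″ {a} {b} a∈ b∈ eq with a ≟ v | b ≟ v
    ... | yes refl | yes refl = refl
    ... | yes refl | no  b≢v  = contradiction (sym eq) (fresh (proj₁ b∈) b≢v)
    ... | no  a≢v  | yes refl = contradiction eq (fresh (proj₁ a∈) a≢v)
    ... | no  a≢v  | no  b≢v  = inj′ (drop a≢v a∈) (drop b≢v b∈)
      (trans (sym (old a≢v)) (trans eq (old b≢v)))

InjectiveOnBags : ∀ {q n m} → (Fin q → Subset n) → List (Fin q) → (Fin n → Fin m) → Set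
InjectiveOnBags bag ts c = ∀ {s} → s ∈ ts → InjectiveOn (_∈ₛ bag s) c

colouring : ∀ {q n m ts} {bag : Fin q → Subset n} → (∀ t → ∣ bag t ∣ ≤ suc m) →
            JoinTree bag ts → Σ[ c ∈ (Fin n → Fin (suc m)) ] InjectiveOnBags bag ts c
colouring small (root r)
  -- At the root no vertex is fixed, so the constant colouring is injective on the fixed ones
  -- vacuously.
  with recolour (small r) (λ _ → no id) (const zero) (λ { (_ , ()) }) (allFin _)
... | c , _ , _ , inj = c , λ { (here refl) u∈ v∈ →
  inj (u∈ , inj₂ (∈-allFin _)) (v∈ , inj₂ (∈-allFin _)) }
colouring {bag = bag} small (attach {t} {p} {ts} _ p∈ rip jt) with colouring small jt
... | c , inj
  with recolour (small t) (_∈ₛ? bag p) c (λ (_ , u∈) (_ , v∈) → inj p∈ u∈ v∈) (allFin _)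
...   | c′ , onB , offB , inj′ = c′ , λ
  { (here refl) u∈ v∈ → inj′ (u∈ , inj₂ (∈-allFin _)) (v∈ , inj₂ (∈-allFin _))
  ; (there s∈)  u∈ v∈ eq → inj s∈ u∈ v∈ (trans (sym (same s∈ u∈)) (trans eq (same s∈ v∈)))
  }
  where
  -- A recoloured vertex is in the bag of `t` but not in that of `p`, so by running intersection it
  -- is in no earlier bag.
  same : ∀ {s v} → s ∈ ts → v ∈ₛ bag s → c′ v ≡ c v
  same {v = v} s∈ v∈s with v ∈ₛ? bag t
  ... | no  v∉t = offB v v∉t
  ... | yes v∈t = [ (λ v∉p → contradiction (rip s∈ v∈t v∈s) v∉p) , id ]′ (onB v v∈t)

-- Expressions for parts of G.  The label zero is the dead one.

module Parts (G : Graph) (k : ℕ) where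
  open Graph G

  Label : Set
  Label = Fin (suc k)

  -- H is a labelled copy of a part of G with vertex set D, except that a vertex
  -- whose label is in L may have several copies.
  record Realises (H : LabelledGraph (suc k)) (L : List Label)
                  (D : Vertex → Set) (lab : Vertex → Label) (R : Rel Vertex 0ℓ) : Set where
    private module H = LabelledGraph H
    field
      D?        : ∀ v → Dec (D v)
      emb       : H.Vertex → Vertex
      emb-label : ∀ x → H.label x ≡ lab (emb x)
      emb-∈     : ∀ x → D (emb x)
      cover     : ∀ {v} → D v → ∃[ x ] emb x ≡ v
      sound     : ∀ {x y} → x H.~ y → emb x ~ emb y
      complete  : ∀ {u v} → R u v → ∃[ x ] ∃[ y ] (emb x ≡ u × emb y ≡ v × x H.~ y)
      injective : ∀ {x y} → emb x ≡ emb y → x ≡ y ⊎ H.label x ∈ L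

  -- Each live label names at most one vertex of `G`. This lets `η`, `θ` and `ρ`, which act on whole
  -- label classes, address single vertices.
  LiveInjective : (Vertex → Label) → Set
  LiveInjective lab = ∀ {u v} → lab u ≢ zero → lab u ≡ lab v → u ≡ v

  -- The empty graph has no expression, so it is a separate alternative.
  Part : (Vertex → Set) → (Vertex → Label) → Rel Vertex 0ℓ → Set
  Part D lab R = ((∀ v → ¬ D v) × (∀ u v → ¬ R u v))
               ⊎ Σ[ e ∈ FusionTree (suc k) ] Realises ⟦ e ⟧ [] D lab R

  -- The required edges may shrink from `R` to `R′` because `sound` compares with the edges of `G`
  -- and not with `R`.
  adapt : ∀ {H L D D′ lab lab′} {R R′ : Rel Vertex 0ℓ} →
          (∀ {v} → D v → D′ v) → (∀ {v} → D′ v → D v) →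
          (∀ {v} → D v → lab v ≡ lab′ v) → (∀ {u v} → R′ u v → R u v) →
          Realises H L D lab R → Realises H L D′ lab′ R′
  adapt to from lab≡ R⊆ r = record
    { D?        = λ v → map′ to from (D? v)
    ; emb       = emb
    ; emb-label = λ x → trans (emb-label x) (lab≡ (emb-∈ x))
    ; emb-∈     = to ∘ emb-∈
    ; cover     = cover ∘ from
    ; sound     = sound
    ; complete  = complete ∘ R⊆
    ; injective = injective
    }
    where open Realises r

  adaptPart : ∀ {D D′ lab} {R R′ : Rel Vertex 0ℓ} →
              (∀ {v} → D v → D′ v) → (∀ {v} → D′ v → D v) →
              (∀ {u v} → R′ u v → R u v) → Part D lab R → Part D′ lab R′
  adaptPart to from R⊆ (inj₁ (¬D , ¬R)) =
    inj₁ ((λ v → ¬D v ∘ from) , (λ u v → ¬R u v ∘ R⊆))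
  adaptPart to from R⊆ (inj₂ (e , r)) = inj₂ (e , adapt to from (λ _ → refl) R⊆ r)

  -- Gluing parts with disjoint union and `θ`

  module _ {H : LabelledGraph (suc k)} {L : List Label} {D : Vertex → Set}
           {lab : Vertex → Label} {R : Rel Vertex 0ℓ} {i : Label}
           (live : LiveInjective lab) (i≢0 : i ≢ zero) where
    open LabelledGraph H using () renaming (_~_ to _~ᴴ_; label to labelᴴ; Vertex to Vertexᴴ)
    open Fuse i H

    -- Since `i` is live, all vertices labelled `i` are copies of one vertex of `G`. Merging them
    -- leaves a single copy, and `i` drops out of the list of labels with repeated copies.
    fuse-realises : Realises H (i ∷ L) D lab R → Realises (fuse i H) L D lab R
    fuse-realises r = record
      { D?        = D?
      ; emb       = emb′
      ; emb-label = λ { (kept x _) → emb-label x ; (merged m) → sym (lab-owner m) }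
      ; emb-∈     = λ { (kept x _) → emb-∈ x ; (merged m) → proj₂ (proj₂ (owner m)) }
      ; cover     = λ d → let x , eq = cover d in quot x , trans (emb-quot x) eq
      ; sound     = λ {x} {y} → sound′ x y
      ; complete  = complete′
      ; injective = λ {x} {y} → injective′ x y
      }
      where
      open Realises r
      -- The argument of merged is irrelevant, so the vertex of G to which the
      -- merged vertex is sent has to be found again by search.
      owner : .(∃[ x ] labelᴴ x ≡ i) → ∃[ v ] (lab v ≡ i × D v)
      owner m = recompute (any? (λ v → (lab v ≟ i) ×-dec D? v))
        (emb (proj₁ m) , trans (sym (emb-label (proj₁ m))) (proj₂ m) , emb-∈ (proj₁ m))
      lab-owner : .(m : ∃[ x ] labelᴴ x ≡ i) → lab (proj₁ (owner m)) ≡ i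
      lab-owner m = proj₁ (proj₂ (owner m))
      emb′ : Fused → Vertex
      emb′ (kept x _) = emb x
      emb′ (merged m) = proj₁ (owner m)
      owner-unique : ∀ .(m : ∃[ x ] labelᴴ x ≡ i) {x} → labelᴴ x ≡ i →
                     emb x ≡ proj₁ (owner m)
      owner-unique m {x} eq = live
        (λ z → i≢0 (trans (sym lx) z))
        (trans lx (sym (lab-owner m)))
        where
        lx : lab (emb x) ≡ i
        lx = trans (sym (emb-label x)) eq
      quot : Vertexᴴ → Fused
      quot x with labelᴴ x ≟ i
      ... | yes eq = merged (x , eq)
      ... | no  ne = kept x ne
      emb-quot : ∀ x → emb′ (quot x) ≡ emb x
      emb-quot x with labelᴴ x ≟ i
      ... | yes eq = sym (owner-unique (x , eq) eq)
      ... | no  ne = refl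
      sound′ : ∀ x y → fusedAdj x y → emb′ x ~ emb′ y
      sound′ (kept x _) (kept y _) a = sound a
      sound′ (kept x _) (merged m) (w , lw , a) =
        subst (emb x ~_) (owner-unique m lw) (sound a)
      sound′ (merged m) (kept y _) (w , lw , a) =
        subst (_~ emb y) (owner-unique m lw) (sound a)
      quot-adj : ∀ {x y} → x ~ᴴ y → fusedAdj (quot x) (quot y)
      quot-adj {x} {y} a with labelᴴ x ≟ i | labelᴴ y ≟ i
      -- Both ends would be copies of the same vertex, and their edge a loop in `G`.
      ... | yes p | yes q = contradiction
        (subst (emb x ~_)
          (trans (owner-unique (x , p) q) (sym (owner-unique (x , p) p))) (sound a))
        ~-irrefl
      ... | yes p | no  _ = x , p , a
      ... | no  _ | yes q = y , q , a
      ... | no  _ | no  _ = a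
      complete′ : ∀ {u v} → R u v →
                  ∃[ x ] ∃[ y ] (emb′ x ≡ u × emb′ y ≡ v × fusedAdj x y)
      complete′ uv with complete uv
      ... | x , y , refl , refl , a = quot x , quot y , emb-quot x , emb-quot y , quot-adj a
      kept≢merged : ∀ {x} .(ne : labelᴴ x ≢ i) .(m : ∃[ x ] labelᴴ x ≡ i) →
                    emb x ≢ proj₁ (owner m)
      kept≢merged {x} ne m eq = ⊥-elim-irr
        (ne (trans (emb-label x) (trans (cong lab eq) (lab-owner m))))
      injective′ : ∀ x y → emb′ x ≡ emb′ y → x ≡ y ⊎ fusedLabel x ∈ L
      injective′ (kept x ne) (kept y _) eq with injective eq
      ... | inj₁ refl         = inj₁ refl
      ... | inj₂ (here lx)    = ⊥-elim-irr (ne lx)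
      ... | inj₂ (there lx∈)  = inj₂ lx∈
      injective′ (kept x ne) (merged m) eq = contradiction eq (kept≢merged ne m)
      injective′ (merged m) (kept y ne) eq = contradiction (sym eq) (kept≢merged ne m)
      injective′ (merged _) (merged _)  _  = inj₁ refl

  fuse-all : ∀ {D lab} {R : Rel Vertex 0ℓ} → LiveInjective lab → ∀ {L} → All (_≢ zero) L →
             ∀ e → Realises ⟦ e ⟧ L D lab R → Part D lab R
  fuse-all live []        e r = inj₂ (e , r)
  fuse-all live (i≢0 ∷ L) e r = fuse-all live L (θ _ e) (fuse-realises live i≢0 r)

  liveLabels : List Label
  liveLabels = map suc (allFin k)

  ∈-liveLabels : ∀ {l} → l ≢ zero → l ∈ liveLabels
  ∈-liveLabels {zero}  l≢0 = contradiction refl l≢0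
  ∈-liveLabels {suc l} _   = ∈-map⁺ suc (∈-allFin l)

  -- Two copies arise only for a vertex on both sides, and `shared` makes its label live.
  union-realises :
    ∀ {H K D D′ lab} {R R′ : Rel Vertex 0ℓ} → (∀ {v} → D v → D′ v → lab v ≢ zero) →
    Realises H [] D lab R → Realises K [] D′ lab R′ →
    Realises (disjointUnion H K) liveLabels (λ v → D v ⊎ D′ v) lab (λ u v → R u v ⊎ R′ u v)
  union-realises {H} {K} {D} {D′} shared r r′ = record
    { D?        = λ v → D? r v ⊎-dec D? r′ v
    ; emb       = emb∪
    ; emb-label = λ { (inj₁ x) → emb-label r x ; (inj₂ y) → emb-label r′ y }
    ; emb-∈     = λ { (inj₁ x) → inj₁ (emb-∈ r x) ; (inj₂ y) → inj₂ (emb-∈ r′ y) }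
    ; cover     = λ
        { (inj₁ d) → let x , eq = cover r d in inj₁ x , eq
        ; (inj₂ d) → let y , eq = cover r′ d in inj₂ y , eq
        }
    ; sound     = λ
        { {inj₁ _} {inj₁ _} a → sound r a
        ; {inj₂ _} {inj₂ _} a → sound r′ a
        }
    ; complete  = λ
        { (inj₁ uv) → let x , y , eqs = complete r uv in inj₁ x , inj₁ y , eqs
        ; (inj₂ uv) → let x , y , eqs = complete r′ uv in inj₂ x , inj₂ y , eqs
        }
    ; injective = λ {x} {y} → injective∪ x y
    }
    where
    open Realises
    open DisjointUnion H K using (unionLabel)
    emb∪ : LabelledGraph.Vertex H ⊎ LabelledGraph.Vertex K → Vertex
    emb∪ = [ emb r , emb r′ ]′
    injective∪ : ∀ x y → emb∪ x ≡ emb∪ y → x ≡ y ⊎ unionLabel x ∈ liveLabels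
    injective∪ (inj₁ x) (inj₁ y) eq with injective r eq
    ... | inj₁ refl = inj₁ refl
    injective∪ (inj₂ x) (inj₂ y) eq with injective r′ eq
    ... | inj₁ refl = inj₁ refl
    injective∪ (inj₁ x) (inj₂ y) eq = inj₂ (∈-liveLabels λ z →
      shared (emb-∈ r x) (subst D′ (sym eq) (emb-∈ r′ y)) (trans (sym (emb-label r x)) z))
    injective∪ (inj₂ x) (inj₁ y) eq = inj₂ (∈-liveLabels λ z →
      shared (subst D (sym eq) (emb-∈ r y)) (emb-∈ r′ x) (trans (sym (emb-label r′ x)) z))

  combine : ∀ {D D′ lab} {R R′ : Rel Vertex 0ℓ} → LiveInjective lab →
            (∀ {v} → D v → D′ v → lab v ≢ zero) → Part D lab R → Part D′ lab R′ →
            Part (λ v → D v ⊎ D′ v) lab (λ u v → R u v ⊎ R′ u v)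
  combine live shared (inj₁ (¬D , ¬R)) p′ =
    adaptPart inj₂ [ ⊥-elim ∘ ¬D _ , id ]′ [ ⊥-elim ∘ ¬R _ _ , id ]′ p′
  combine live shared p@(inj₂ _) (inj₁ (¬D , ¬R)) =
    adaptPart inj₁ [ id , ⊥-elim ∘ ¬D _ ]′ [ id , ⊥-elim ∘ ¬R _ _ ]′ p
  combine live shared (inj₂ (e , r)) (inj₂ (e′ , r′)) =
    fuse-all live (map⁺ (All.universal (λ _ ()) (allFin k))) (e ⊕ e′)
      (union-realises shared r r′)

  -- Turning labels dead

  relabel-realises : ∀ {H L D lab} {R : Rel Vertex 0ℓ} i j → Realises H [] D lab R →
                     Realises (relabel i j H) L D (relabelLabel i j ∘ lab) R
  relabel-realises i j r = record
    { D?        = D?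
    ; emb       = emb
    ; emb-label = cong (relabelLabel i j) ∘ emb-label
    ; emb-∈     = emb-∈
    ; cover     = cover
    ; sound     = sound
    ; complete  = complete
    ; injective = [ inj₁ , (λ ()) ]′ ∘ injective
    }
    where open Realises r

  -- `vs` lists the vertices whose label may still differ from the target. Each one with dead target
  -- has its label sent to `zero` by one `ρ`; by `live` no other live vertex is affected.
  forget : ∀ {D lab} {R : Rel Vertex 0ℓ} (lab′ : Vertex → Label) → LiveInjective lab →
           (vs : List Vertex) →
           (∀ {v} → D v → lab v ≡ lab′ v ⊎ (v ∈ vs × lab′ v ≡ zero)) →
           ∀ e → Realises ⟦ e ⟧ [] D lab R → Part D lab′ R
  forget lab′ live [] near e r =
    inj₂ (e , adapt id id (λ d → [ id , (λ ()) ]′ (near d)) id r)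
  forget {D} {lab} lab′ live (u ∷ us) near e r with lab′ u ≟ zero
  ... | no  u≢0 = forget lab′ live us near′ e r
    where
    near′ : ∀ {v} → D v → lab v ≡ lab′ v ⊎ (v ∈ us × lab′ v ≡ zero)
    near′ d with near d
    ... | inj₁ eq               = inj₁ eq
    ... | inj₂ (here refl , z)  = contradiction z u≢0
    ... | inj₂ (there v∈ , z)   = inj₂ (v∈ , z)
  ... | yes u≡0 =
    forget lab′ live″ us near″ (ρ (lab u) zero e) (relabel-realises (lab u) zero r)
    where
    lab″ : Vertex → Label
    lab″ = relabelLabel (lab u) zero ∘ lab
    live″ : LiveInjective lab″
    live″ {a} {b} a≢0 eq with lab a ≟ lab u | lab b ≟ lab u
    ... | yes _ | _     = contradiction refl a≢0
    ... | no  _ | yes _ = contradiction eq a≢0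
    ... | no  _ | no  _ = live a≢0 eq
    near″ : ∀ {v} → D v → lab″ v ≡ lab′ v ⊎ (v ∈ us × lab′ v ≡ zero)
    near″ {v} d with lab v ≟ lab u | near d
    ... | yes _  | inj₂ (_ , z)          = inj₁ (sym z)
    ... | no  _  | inj₁ eq               = inj₁ eq
    ... | no ne  | inj₂ (here refl , _)  = contradiction refl ne
    ... | no  _  | inj₂ (there v∈ , z)   = inj₂ (v∈ , z)
    -- Either the shared label is already dead and stays so, or it is live and `v` is `u` itself,
    -- whose target is dead.
    ... | yes eq | inj₁ eq′ with lab v ≟ zero
    ...   | yes z = inj₁ (trans (sym z) eq′)
    ...   | no nz = inj₁ (sym (trans (cong lab′ (live nz eq)) u≡0))

  forgetPart : ∀ {D lab} {R : Rel Vertex 0ℓ} (lab′ : Vertex → Label) → LiveInjective lab →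
               (∀ {v} → D v → lab v ≡ lab′ v ⊎ lab′ v ≡ zero) →
               Part D lab R → Part D lab′ R
  forgetPart lab′ live near (inj₁ empty)   = inj₁ empty
  forgetPart lab′ live near (inj₂ (e , r)) =
    forget lab′ live (allFin _) ([ inj₁ , inj₂ ∘ (∈-allFin _ ,_) ]′ ∘ near) e r

  -- Subgraphs induced on live vertices

  vertexPart : ∀ {lab} v → Part (_≡ v) lab (λ _ _ → ⊥)
  vertexPart {lab} v = inj₂ (lab v ⟨ 1 ⟩ , record
    { D?        = _≟ v
    ; emb       = λ _ → v
    ; emb-label = λ _ → refl
    ; emb-∈     = λ _ → refl
    ; cover     = λ { refl → zero , refl }
    ; sound     = λ ()
    ; complete  = λ ()
    ; injective = λ { {zero} {zero} _ → inj₁ refl }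
    })

  Edge : Vertex → Vertex → Rel Vertex 0ℓ
  Edge u v a b = (a ≡ u × b ≡ v) ⊎ (a ≡ v × b ≡ u)

  -- The labels of `u` and `v` are live, so every edge that `η` adds joins a copy of `u` to a copy
  -- of `v`.
  join-realises : ∀ {H D lab} {R : Rel Vertex 0ℓ} {u v} → LiveInjective lab →
                  u ~ v → D u → D v → lab u ≢ zero → lab v ≢ zero →
                  Realises H [] D lab R →
                  Realises (join (lab u) (lab v) H) [] D lab (λ a b → R a b ⊎ Edge u v a b)
  join-realises {lab = lab} {u = u} {v} live u~v du dv u≢0 v≢0 r = record
    { D?        = D?
    ; emb       = emb
    ; emb-label = emb-label
    ; emb-∈     = emb-∈
    ; cover     = cover
    ; sound     = λ
        { (inj₁ a)                 → sound a
        ; (inj₂ (inj₁ (lx , ly)))  → subst₂ _~_ (named u≢0 lx) (named v≢0 ly) u~v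
        ; (inj₂ (inj₂ (lx , ly)))  → subst₂ _~_ (named v≢0 lx) (named u≢0 ly) (~-sym u~v)
        }
    ; complete  = λ
        { (inj₁ a) → let x , y , eqx , eqy , xy = complete a in x , y , eqx , eqy , inj₁ xy
        ; (inj₂ (inj₁ (refl , refl))) →
            let x , eqx = cover du ; y , eqy = cover dv in
            x , y , eqx , eqy , inj₂ (inj₁ (labelled eqx , labelled eqy))
        ; (inj₂ (inj₂ (refl , refl))) →
            let x , eqx = cover dv ; y , eqy = cover du in
            x , y , eqx , eqy , inj₂ (inj₂ (labelled eqx , labelled eqy))
        }
    ; injective = injective
    }
    where
    open Realises r
    named : ∀ {w x} → lab w ≢ zero → _ ≡ lab w → w ≡ emb x
    named {x = x} w≢0 lx = live w≢0 (trans (sym lx) (emb-label x))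
    labelled : ∀ {w x} → emb x ≡ w → _ ≡ lab w
    labelled {x = x} eq = trans (emb-label x) (cong lab eq)

  edgePart : ∀ {D lab} {R : Rel Vertex 0ℓ} {u v} → LiveInjective lab →
             u ~ v → D u → D v → lab u ≢ zero → lab v ≢ zero →
             Part D lab R → Part D lab (λ a b → R a b ⊎ Edge u v a b)
  edgePart live u~v du dv u≢0 v≢0 (inj₁ (¬D , _)) = contradiction du (¬D _)
  edgePart {lab = lab} {u = u} {v} live u~v du dv u≢0 v≢0 (inj₂ (e , r)) =
    inj₂ (η (lab u) (lab v) distinct e , join-realises live u~v du dv u≢0 v≢0 r)
    where
    distinct : lab u ≢ lab v
    distinct eq = ~-irrefl (subst (u ~_) (sym (live u≢0 eq)) u~v)

  module _ {lab : Vertex → Label} (live : LiveInjective lab)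
           {D : Vertex → Set} (D? : ∀ v → Dec (D v)) (D-live : ∀ {v} → D v → lab v ≢ zero) where

    -- Because `combine` merges copies, a repeated entry of `vs` does no harm.
    verticesPart : (vs : List Vertex) → Part (λ v → D v × v ∈ vs) lab (λ _ _ → ⊥)
    verticesPart [] = inj₁ ((λ { _ (_ , ()) }) , (λ _ _ ()))
    verticesPart (v ∷ vs) with D? v
    ... | no ¬d = adaptPart
      (λ (d , v∈) → d , there v∈)
      (λ { (d , here refl) → contradiction d ¬d ; (d , there v∈) → d , v∈ })
      id (verticesPart vs)
    ... | yes d = adaptPart
      [ (λ { refl → d , here refl }) , (λ (d , v∈) → d , there v∈) ]′
      (λ { (_ , here refl) → inj₁ refl ; (d , there v∈) → inj₂ (d , v∈) })
      (λ ())
      (combine live (λ { refl _ → D-live d }) (vertexPart v) (verticesPart vs))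

    InducedOn : List (Vertex × Vertex) → Rel Vertex 0ℓ
    InducedOn es u v = (u ~ v × D u × D v) × (u , v) ∈ es

    edgesPart : (es : List (Vertex × Vertex)) → Part D lab (InducedOn es)
    edgesPart [] =
      adaptPart proj₁ (_, ∈-allFin _) (λ { (_ , ()) }) (verticesPart (allFin _))
    edgesPart ((u , v) ∷ es) with (u ~? v) ×-dec (D? u ×-dec D? v)
    ... | no ¬uv = adaptPart id id
      (λ { (uv , here refl) → contradiction uv ¬uv ; (uv , there ∈es) → uv , ∈es })
      (edgesPart es)
    ... | yes (u~v , du , dv) = adaptPart id id
      (λ { (uv , here refl) → inj₂ (inj₁ (refl , refl)) ; (uv , there ∈es) → inj₁ (uv , ∈es) })
      (edgePart live u~v du dv (D-live du) (D-live dv) (edgesPart es))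

    inducedPart : Part D lab (λ u v → u ~ v × D u × D v)
    inducedPart = adaptPart id id
      (_, ∈-cartesianProduct⁺ (∈-allFin _) (∈-allFin _))
      (edgesPart (cartesianProduct (allFin _) (allFin _)))

  -- With no label allowed repeated copies, `emb` is a bijection onto the vertices of `G`. The empty
  -- alternative is excluded since `G` has a vertex.
  wholePart⇒HasFusionTree :
    ∀ {D lab} {R : Rel Vertex 0ℓ} → (∀ v → D v) → (∀ {u v} → u ~ v → R u v) →
    Part D lab R → HasFusionTree G (suc k)
  wholePart⇒HasFusionTree all edges (inj₁ (¬D , _)) =
    contradiction (all vertex) (¬D vertex)
    where
    first : ∀ {n} → NonZero n → Fin n
    first {suc _} _ = zero
    vertex : Vertex
    vertex = first nonempty
  wholePart⇒HasFusionTree all edges (inj₂ (e , r)) =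
    e , mk↔ₛ′ copy emb (λ x → injective⁰ (emb-copy (emb x))) emb-copy ,
    λ u v → mk⇔ adj (λ a → subst₂ _~_ (emb-copy u) (emb-copy v) (sound a))
    where
    open Realises r
    module H = LabelledGraph ⟦ e ⟧
    injective⁰ : ∀ {x y} → emb x ≡ emb y → x ≡ y
    injective⁰ eq = [ id , (λ ()) ]′ (injective eq)
    copy : Vertex → H.Vertex
    copy v = proj₁ (cover (all v))
    emb-copy : ∀ v → emb (copy v) ≡ v
    emb-copy v = proj₂ (cover (all v))
    adj : ∀ {u v} → u ~ v → copy u H.~ copy v
    adj u~v with complete (edges u~v)
    ... | x , y , refl , refl , xy =
      subst₂ H._~_ (injective⁰ (sym (emb-copy _))) (injective⁰ (sym (emb-copy _))) xy

  -- Eliminating the leaves of a join tree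

  module _ {m : ℕ} {bag : Fin m → Subset order} {c : Vertex → Fin k} where

    bagLabel : Fin m → Vertex → Label
    bagLabel t v with v ∈ₛ? bag t
    ... | yes _ = suc (c v)
    ... | no  _ = zero

    ∈-bag : ∀ {t v} → bagLabel t v ≢ zero → v ∈ₛ bag t
    ∈-bag {t} {v} v≢0 with v ∈ₛ? bag t
    ... | yes v∈ = v∈
    ... | no  _  = contradiction refl v≢0

    bagLabel-∈ : ∀ {t v} → v ∈ₛ bag t → bagLabel t v ≡ suc (c v)
    bagLabel-∈ {t} {v} v∈ with v ∈ₛ? bag t
    ... | yes _  = refl
    ... | no  v∉ = contradiction v∈ v∉

    bagLabel-live : ∀ {t v} → v ∈ₛ bag t → bagLabel t v ≢ zero
    bagLabel-live v∈ eq = contradiction (trans (sym (bagLabel-∈ v∈)) eq) λ ()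

    bagLabel-injective : ∀ {t} → InjectiveOn (_∈ₛ bag t) c → LiveInjective (bagLabel t)
    bagLabel-injective {t} inj {u} {v} u≢0 eq =
      inj u∈ v∈ (suc-injective
        (trans (sym (bagLabel-∈ u∈)) (trans eq (bagLabel-∈ v∈))))
      where
      u∈ : u ∈ₛ bag t
      u∈ = ∈-bag u≢0
      v∈ : v ∈ₛ bag t
      v∈ = ∈-bag (subst (_≢ zero) eq u≢0)

    -- The part D t, R t is what has been absorbed into the remaining node t.
    record Absorbed (ts : List (Fin m)) (D : Fin m → Vertex → Set)
                    (R : Fin m → Rel Vertex 0ℓ) : Set where
      field
        part   : ∀ {t} → t ∈ ts → Part (D t) (bagLabel t) (R t)
        bag⊆   : ∀ {t v} → t ∈ ts → v ∈ₛ bag t → D t v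
        shared : ∀ {s t v} → s ∈ ts → t ∈ ts → s ≢ t → D s v → D t v → v ∈ₛ bag s
        cover  : ∀ v → ∃[ t ] (t ∈ ts × D t v)
        edges  : ∀ {u v} → u ~ v → ∃[ t ] (t ∈ ts × R t u v)

    eliminate : ∀ {ts D R} → JoinTree bag ts → InjectiveOnBags bag ts c →
                Absorbed ts D R → HasFusionTree G (suc k)
    eliminate {D = D} {R} (root r) inj a =
      wholePart⇒HasFusionTree allD allR (part (here refl))
      where
      open Absorbed a
      allD : ∀ v → D r v
      allD v with cover v
      ... | _ , here refl , d = d
      allR : ∀ {u v} → u ~ v → R r u v
      allR u~v with edges u~v
      ... | _ , here refl , uv = uv
    eliminate {D = D} {R} (attach {t} {p} {ts} t∉ p∈ rip jt) inj a =
      eliminate jt (inj ∘ there) (record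
        { part   = part′
        ; bag⊆   = λ s∈ v∈ → inj₁ (bag⊆ (there s∈) v∈)
        ; shared = shared′
        ; cover  = cover′
        ; edges  = edges′
        })
      where
      open Absorbed a
      D′ : Fin m → Vertex → Set
      D′ s v = D s v ⊎ (s ≡ p × D t v)
      R′ : Fin m → Rel Vertex 0ℓ
      R′ s u v = R s u v ⊎ (s ≡ p × R t u v)
      ≢t : ∀ {s} → s ∈ ts → s ≢ t
      ≢t s∈ refl = t∉ s∈
      -- A vertex absorbed into `t` that lies in the bag of `p` belongs to both nodes, so `shared`
      -- puts it in the bag of `t`, and both labels are its colour.
      t-near-p : ∀ {v} → D t v → bagLabel t v ≡ bagLabel p v ⊎ bagLabel p v ≡ zero
      t-near-p {v} d with v ∈ₛ? bag p
      ... | no  _   = inj₂ refl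
      ... | yes v∈p = inj₁ (bagLabel-∈
        (shared (here refl) (there p∈) (≢t p∈ ∘ sym) d (bag⊆ (there p∈) v∈p)))
      part′ : ∀ {s} → s ∈ ts → Part (D′ s) (bagLabel s) (R′ s)
      part′ {s} s∈ with s ≟ p
      ... | no s≢p = adaptPart
        inj₁ [ id , (λ (eq , _) → contradiction eq s≢p) ]′
        [ id , (λ (eq , _) → contradiction eq s≢p) ]′ (part (there s∈))
      ... | yes refl = adaptPart
        [ inj₁ , inj₂ ∘ (refl ,_) ]′ [ inj₁ , inj₂ ∘ proj₂ ]′ [ inj₁ , inj₂ ∘ proj₂ ]′
        (combine (bagLabel-injective (inj (there p∈)))
          -- A vertex absorbed into both `p` and `t` lies in the bag of `p`, so it is live there and
          -- its copies get merged.
          (λ d d′ → bagLabel-live (shared (there p∈) (here refl) (≢t p∈) d d′))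
          (part (there p∈))
          (forgetPart (bagLabel p) (bagLabel-injective (inj (here refl))) t-near-p
            (part (here refl))))
      shared′ : ∀ {s s′ v} → s ∈ ts → s′ ∈ ts → s ≢ s′ → D′ s v → D′ s′ v → v ∈ₛ bag s
      shared′ s∈ s′∈ s≢s′ (inj₁ d) (inj₁ d′) = shared (there s∈) (there s′∈) s≢s′ d d′
      shared′ s∈ s′∈ s≢s′ (inj₁ d) (inj₂ (refl , d′)) =
        shared (there s∈) (here refl) (≢t s∈) d d′
      -- Here `v` came to `p` from `t`. It lies in the bags of `t` and `s′`, hence by running
      -- intersection in that of `p`.
      shared′ s∈ s′∈ s≢s′ (inj₂ (refl , d)) (inj₁ d′) = rip s′∈
        (shared (here refl) (there s′∈) (≢t s′∈ ∘ sym) d d′)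
        (shared (there s′∈) (here refl) (≢t s′∈) d′ d)
      shared′ s∈ s′∈ s≢s′ (inj₂ (refl , _)) (inj₂ (refl , _)) = contradiction refl s≢s′
      cover′ : ∀ v → ∃[ s ] (s ∈ ts × D′ s v)
      cover′ v with cover v
      ... | _ , here refl , d = p , p∈ , inj₂ (refl , d)
      ... | s , there s∈  , d = s , s∈ , inj₁ d
      edges′ : ∀ {u v} → u ~ v → ∃[ s ] (s ∈ ts × R′ s u v)
      edges′ u~v with edges u~v
      ... | _ , here refl , uv = p , p∈ , inj₂ (refl , uv)
      ... | s , there s∈  , uv = s , s∈ , inj₁ uv

-- From decompositions to expressions

module _ {G : Graph} (T : TreeDecomposition G) where
  open TreeDecomposition T

  -- Bags of size at most `suc k` need `suc k` colours, and the dead label is one more. At the start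
  -- each node holds the subgraph induced by its own bag.
  decomposition⇒HasFusionTree : ∀ {k} → (∀ t → ∣ bag t ∣ ≤ suc k) → Graph.Vertex tree →
                                HasFusionTree G (suc (suc k))
  decomposition⇒HasFusionTree {k} small r with joinTree-all T r
  ... | ts , jt , ∈ts with colouring small jt
  ...   | c , inj = Parts.eliminate G (suc k) jt inj (record
    { part   = λ t∈ → inducedPart (bagLabel-injective (inj t∈)) (_∈ₛ? bag _) bagLabel-live
    ; bag⊆   = λ _ → id
    ; shared = λ _ _ _ v∈ _ → v∈
    ; cover  = λ v → let t , v∈ = vertex-cover v in t , ∈ts t , v∈
    ; edges  = λ u~v → let t , u∈ , v∈ = edge-cover u~v in t , ∈ts t , u~v , u∈ , v∈
    })
    where open Parts G (suc k)

theorem2 : (G : Graph) (k : ℕ) → TreeWidth G k → FusionWidthAtMost G (k + 2)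
theorem2 G k ((D , small , t₀ , _) , _) =
  (k + 2 , ≤-refl , fusionTree) , λ w (_ , least) → least (k + 2) fusionTree
  where
  fusionTree : HasFusionTree G (k + 2)
  fusionTree = subst (HasFusionTree G) (+-comm 2 k) (decomposition⇒HasFusionTree D small t₀)
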